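{- Let $A$ be a chop-star-free formula in ITL-NL, $p$ be a propositional variable and $0\le n_1\le n_2<\omega$. Then there exists a chop-star-free ITL-NL formula $A'$ such that $\models A'\equiv\exists_{n_1}^{n_2}p\,A$.
   Context: $V$ is a vocabulary of propositional variables and $\Sigma=\mathcal P(V)$. Chop-star-free ITL-NL formulas (which do not include quantifiers): $A::=\bot\mid q\mid A\supset A\mid\bigcirc A\mid A;A\mid\Diamond_l A\mid\Diamond_r A$, with $q\in V$. For $\sigma:\mathbb Z\to\Sigma$ and integers $i\le j$: $\sigma,i,j\not\models\bot$; $\sigma,i,j\models q$ iff $q\in\sigma^i$; $\sigma,i,j\models A\supset B$ iff $\sigma,i,j\not\models A$ or $\sigma,i,j\models B$; $\sigma,i,j\models\bigcirc A$ iff $i<j$ and $\sigma,i+1,j\models A$; $\sigma,i,j\models A;B$ iff $\sigma,i,k\models A$ and $\sigma,k,j\models B$ for some $k\in\{i,\ldots,j\}$; $\sigma,i,j\models\Diamond_l A$ iff $\sigma,k,i\models A$ for some $k\le i$; $\sigma,i,j\models\Diamond_r A$ iff $\sigma,j,k\models A$ for some $k\ge j$. $\models A$ means $\sigma,i,j\models A$ for all $\sigma$ and all $i\le j$. Bounded propositional quantification: $\sigma,i,j\models\exists_{n_1}^{n_2}p\,A$ iff there exists $\sigma':\mathbb Z\to\Sigma$ such that $\sigma'\sim_p\sigma$, $\sigma',i,j\models A$, and $n_1\le\#\{k\in\mathbb Z:p\in\sigma'^k\}\le n_2$. Here $\sigma'\sim_p\sigma$ means $\sigma^k\setminus\{p\}=\sigma'^k\setminus\{p\}$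 for all $k\in\mathbb Z$. -}

module Defs where

open import Data.Empty using (⊥)
open import Data.Integer using (ℤ; suc; _≤_; _<_)
open import Data.List using (List; length)
import Data.List.Membership.Propositional as List
open import Data.List.Relation.Unary.Unique.Propositional using (Unique)
import Data.Nat as ℕ
open import Data.Nat using (ℕ)
open import Data.Product using (_×_; ∃-syntax)
open import Data.Sum using (_⊎_)
open import Function.Bundles using (_⇔_)
open import Level using (0ℓ)
open import Relation.Binary.PropositionalEquality using (_≡_)
open import Relation.Nullary using (¬_)
open import Relation.Unary using (Pred; _∈_; _∖_; ｛_｝; _≐_)

infixr 6 _⊃_
infixr 7 _⨾_
infix  8 ○_ ◇ₗ_ ◇ᵣ_
infix  4 _⟨_,_⟩⊨_ _⟨_,_⟩⊨∃[_,_]_∙_ _∼[_]_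

-- Chop-star-free and quantifier-free ITL-NL; ⨾ is chop.
data Formula (V : Set) : Set where
  ⊥ᶠ       : Formula V
  var      : V → Formula V
  _⊃_ _⨾_  : Formula V → Formula V → Formula V
  ○_       : Formula V → Formula V
  ◇ₗ_ ◇ᵣ_  : Formula V → Formula V

Trace : Set → Set₁
Trace V = ℤ → Pred V 0ℓ

-- Only meaningful when i ≤ j; every clause preserves this condition.
_⟨_,_⟩⊨_ : {V : Set} → Trace V → ℤ → ℤ → Formula V → Set
σ ⟨ i , j ⟩⊨ ⊥ᶠ      = ⊥
σ ⟨ i , j ⟩⊨ var q   = q ∈ σ i
σ ⟨ i , j ⟩⊨ (A ⊃ B) = (¬ (σ ⟨ i , j ⟩⊨ A)) ⊎ (σ ⟨ i , j ⟩⊨ B)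
σ ⟨ i , j ⟩⊨ (○ A)   = i < j × σ ⟨ suc i , j ⟩⊨ A
σ ⟨ i , j ⟩⊨ (A ⨾ B) = ∃[ k ] (i ≤ k × k ≤ j × σ ⟨ i , k ⟩⊨ A × σ ⟨ k , j ⟩⊨ B)
σ ⟨ i , j ⟩⊨ (◇ₗ A)  = ∃[ k ] (k ≤ i × σ ⟨ k , i ⟩⊨ A)
σ ⟨ i , j ⟩⊨ (◇ᵣ A)  = ∃[ k ] (j ≤ k × σ ⟨ j , k ⟩⊨ A)

_∼[_]_ : {V : Set} → Trace V → V → Trace V → Set
σ′ ∼[ p ] σ = ∀ k → (σ k ∖ ｛ p ｝) ≐ (σ′ k ∖ ｛ p ｝)

-- Elements are enumerated by a duplicate-free list, not by a bijection from
-- Fin n onto Σ ℤ S, because S k may have several inhabitants for a single k.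
HasCardinality : Pred ℤ 0ℓ → ℕ → Set
HasCardinality S n =
  ∃[ ks ] (Unique ks × length ks ≡ n × (∀ k → (k List.∈ ks) ⇔ (k ∈ S)))

_⟨_,_⟩⊨∃[_,_]_∙_ : {V : Set} → Trace V → ℤ → ℤ → ℕ → ℕ → V → Formula V → Set₁
σ ⟨ i , j ⟩⊨∃[ n₁ , n₂ ] p ∙ A =
  ∃[ σ′ ] (σ′ ∼[ p ] σ × σ′ ⟨ i , j ⟩⊨ A ×
    ∃[ n ] (HasCardinality (λ k → p ∈ σ′ k) n × n₁ ℕ.≤ n × n ℕ.≤ n₂))

{-# OPTIONS --safe #-}
module Submission where

-- Fix points y₀ ≤ … ≤ yₘ₊₁ of the time line and consider the unions of
-- "rectangles", a rectangle being a tuple of formulas, one for each interval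
-- [yₛ , yₛ₊₁].  The relations on sorted points so obtained are closed under the
-- Boolean operations, and under ∃ z as well: z falls between two neighbours, or
-- before y₀, or after yₘ₊₁, and can be eliminated from a rectangle by means of
-- chop, ◇ₗ or ◇ᵣ respectively.  So every relation on points that is first-order
-- definable from ≤ and the propositional variables is such a union, whatever
-- the order of its arguments.  For an extension of p given by a list of n points,
-- the truth of A at [i , j] is such a relation in i, j and the n points; it
-- remains to quantify over these points, and for the two points i ≤ j a union of
-- rectangles is a disjunction of formulas.

open import Defs
open import Axiom.ExcludedMiddle using (ExcludedMiddle)
open import Data.Empty using (⊥; ⊥-elim)
open import Data.Fin using (Fin; zero; suc; punchIn; toℕ; fromℕ<)
open import Data.Fin.Properties using (toℕ-fromℕ<; toℕ≤pred[n])
open import Data.Integer using (ℤ; _≤_; _<_)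
import Data.Integer as ℤ
import Data.Integer.Properties as ℤ
open import Data.List as List using (List; []; _∷_; _++_; cartesianProductWith)
open import Data.List.Membership.Propositional using () renaming (_∈_ to _∈ˡ_)
open import Data.List.Relation.Unary.All.Properties using (All¬⇒¬Any; ¬Any⇒All¬)
open import Data.List.Relation.Unary.AllPairs using ([]; _∷_)
open import Data.List.Relation.Unary.Any using (Any; here; there)
import Data.List.Relation.Unary.Any.Properties as Any
open import Data.List.Relation.Unary.Unique.Propositional using (Unique)
open import Data.Nat as ℕ using (ℕ; zero; suc)
open import Data.Product using (Σ-syntax; ∃-syntax; _×_; _,_; proj₁; proj₂)
open import Data.Product.Function.NonDependent.Propositional using (_×-⇔_)
open import Data.Sum using (_⊎_; inj₁; inj₂; [_,_]′; fromInj₁)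
open import Data.Sum.Function.Propositional using (_⊎-⇔_)
open import Data.Unit using (⊤)
open import Data.Vec as Vec using (Vec; []; _∷_; lookup; insertAt; toList; fromList)
open import Data.Vec.Properties
  using (insertAt-lookup; insertAt-punchIn; length-toList; toList∘fromList; map-∘; map-cong)
open import Data.Vec.Relation.Unary.Linked using (Linked; [-]; _∷_)
open import Function using (_∘_; id)
open import Function.Bundles using (_⇔_; mk⇔; Equivalence)
open import Function.Properties.Equivalence using () renaming (trans to ⇔-trans)
open import Function.Related.TypeIsomorphisms using (¬-cong-⇔)
open import Level using (0ℓ)
open import Relation.Binary.PropositionalEquality
  using (_≡_; _≢_; refl; sym; trans; cong₂; subst)
open import Relation.Nullary using (¬_; yes; no)
open import Relation.Unary using (_∈_)

open Equivalence using (to; from)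

private
  variable
    V     : Set
    k m n : ℕ
    A B   : Formula V
    σ τ   : Trace V
    i j   : ℤ

-- Derived connectives, and invariance of truth under equivalence of traces.

infix  8 ¬ᶠ_
infixr 7 _∧ᶠ_
infixr 6 _∨ᶠ_

⊤ᶠ : Formula V
⊤ᶠ = ⊥ᶠ ⊃ ⊥ᶠ

¬ᶠ_ : Formula V → Formula V
¬ᶠ A = A ⊃ ⊥ᶠ

_∧ᶠ_ _∨ᶠ_ : Formula V → Formula V → Formula V
A ∧ᶠ B = ¬ᶠ (A ⊃ ¬ᶠ B)
A ∨ᶠ B = ¬ᶠ A ⊃ B

-- Traces are predicate-valued, so a trace chosen by the quantifier agrees with its description by a
-- list of points only up to logical equivalence; truth has to be transported along that.
⊨-cong : (∀ l q → (q ∈ σ l) ⇔ (q ∈ τ l)) →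
         ∀ (A : Formula V) {i j} → (σ ⟨ i , j ⟩⊨ A) ⇔ (τ ⟨ i , j ⟩⊨ A)
⊨-cong σ≈τ ⊥ᶠ      = mk⇔ id id
⊨-cong σ≈τ (var q) = σ≈τ _ q
⊨-cong σ≈τ (A ⊃ B) = ¬-cong-⇔ (⊨-cong σ≈τ A) ⊎-⇔ ⊨-cong σ≈τ B
⊨-cong σ≈τ (A ⨾ B) = mk⇔
  (λ (l , i≤l , l≤j , a , b) → l , i≤l , l≤j , to (⊨-cong σ≈τ A) a , to (⊨-cong σ≈τ B) b)
  (λ (l , i≤l , l≤j , a , b) → l , i≤l , l≤j , from (⊨-cong σ≈τ A) a , from (⊨-cong σ≈τ B) b)
⊨-cong σ≈τ (○ A)   = mk⇔ id id ×-⇔ ⊨-cong σ≈τ A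
⊨-cong σ≈τ (◇ₗ A)  = mk⇔ (λ (l , l≤i , a) → l , l≤i , to (⊨-cong σ≈τ A) a)
                         (λ (l , l≤i , a) → l , l≤i , from (⊨-cong σ≈τ A) a)
⊨-cong σ≈τ (◇ᵣ A)  = mk⇔ (λ (l , j≤l , a) → l , j≤l , to (⊨-cong σ≈τ A) a)
                         (λ (l , j≤l , a) → l , j≤l , from (⊨-cong σ≈τ A) a)

-- Sorted tuples of integers.

Sorted : Vec ℤ n → Set
Sorted = Linked _≤_

first≤lookup : {ys : Vec ℤ (suc n)} → Sorted ys → ∀ a → lookup ys zero ≤ lookup ys a
first≤lookup {ys = _ ∷ _}     s         zero    = ℤ.≤-refl
first≤lookup {ys = _ ∷ _ ∷ _} (x≤y ∷ s) (suc a) = ℤ.≤-trans x≤y (first≤lookup s a)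

insert-sorted : ∀ z {ys : Vec ℤ (suc n)} → Sorted ys → ∃[ t ] Sorted (insertAt ys t z)
insert-sorted z {x ∷ _} s with ℤ.≤-total z x
insert-sorted z {x ∷ _} s           | inj₁ z≤x = zero , z≤x ∷ s
insert-sorted z {x ∷ []} [-]        | inj₂ x≤z = suc zero , x≤z ∷ [-]
insert-sorted z {x ∷ _ ∷ _} (x≤y ∷ s) | inj₂ x≤z with insert-sorted z s
-- Position `zero` in the tail means that `z` comes directly after `x`, so the link `x≤z` replaces
-- `x≤y`.
... | zero  , s′ = suc zero , x≤z ∷ s′
... | suc t , s′ = suc (suc t) , x≤y ∷ s′

-- Inserting `z` shifts the old positions by `punchIn t`; renaming the arguments accordingly leaves
-- their values unchanged and makes `z` available as a further argument.
lookup-insertAt : ∀ (ys : Vec ℤ n) t z (vs : Vec (Fin n) k) →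
  Vec.map (lookup (insertAt ys t z)) (t ∷ Vec.map (punchIn t) vs) ≡ z ∷ Vec.map (lookup ys) vs
lookup-insertAt ys t z vs = cong₂ _∷_ (insertAt-lookup ys t z)
  (trans (sym (map-∘ (lookup (insertAt ys t z)) (punchIn t) vs))
         (map-cong (insertAt-punchIn ys t z) vs))

-- Rectangles and the operations on them.

Rectangle : Set → ℕ → Set
Rectangle V n = Vec (Formula V) n

infix 4 _⟨_⟩⊨*_

_⟨_⟩⊨*_ : Trace V → Vec ℤ (suc n) → Rectangle V n → Set
σ ⟨ ys ⟩⊨* []               = ⊤
σ ⟨ x ∷ y ∷ ys ⟩⊨* (A ∷ As) = (σ ⟨ x , y ⟩⊨ A) × (σ ⟨ y ∷ ys ⟩⊨* As)

full : Rectangle V n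
full = Vec.replicate _ ⊤ᶠ

⊨*-full : (ys : Vec ℤ (suc n)) → σ ⟨ ys ⟩⊨* full
⊨*-full (_ ∷ [])     = _
⊨*-full (_ ∷ y ∷ ys) = inj₁ id , ⊨*-full (y ∷ ys)

-- A variable is read at the left end of an interval. The last point begins none of the intervals,
-- so there it is read through `◇ᵣ`.
at : V → Fin (suc (suc m)) → Rectangle V (suc m)
at             q zero       = var q ∷ full
at {m = zero}  q (suc zero) = ◇ᵣ var q ∷ []
at {m = suc _} q (suc a)    = ⊤ᶠ ∷ at q a

⊨*-at : ∀ {q : V} a (ys : Vec ℤ (suc (suc m))) →
        (σ ⟨ ys ⟩⊨* at q a) ⇔ (q ∈ σ (lookup ys a))
⊨*-at zero (x ∷ y ∷ ys) = mk⇔ proj₁ (λ h → h , ⊨*-full (y ∷ ys))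
⊨*-at {m = zero} (suc zero) (x ∷ y ∷ []) =
  mk⇔ (λ ((_ , _ , h) , _) → h) (λ h → (y , ℤ.≤-refl , h) , _)
⊨*-at {m = suc _} (suc a) (x ∷ y ∷ ys) =
  mk⇔ (to (⊨*-at a (y ∷ ys)) ∘ proj₂) (λ h → inj₁ id , from (⊨*-at a (y ∷ ys)) h)

-- For sorted points, y_a ≤ y_b fails unless a ≤ b or all intervals between y_b
-- and y_a are single points, that is, satisfy ¬ᶠ (○ ⊤ᶠ).
leq : Fin (suc n) → Fin (suc n) → Rectangle V n
leq {n = zero}  _       _       = []
leq {n = suc _} zero    _       = full
leq {n = suc _} (suc a) zero    = ¬ᶠ (○ ⊤ᶠ) ∷ leq a zero
leq {n = suc _} (suc a) (suc b) = ⊤ᶠ ∷ leq a b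

⊨*-leq : ∀ a b {ys : Vec ℤ (suc n)} → Sorted ys →
         (σ ⟨ ys ⟩⊨* leq a b) ⇔ (lookup ys a ≤ lookup ys b)
⊨*-leq {n = zero} zero zero {_ ∷ []} _ = mk⇔ (λ _ → ℤ.≤-refl) _
⊨*-leq {n = suc _} zero b {ys} s = mk⇔ (λ _ → first≤lookup s b) (λ _ → ⊨*-full ys)
⊨*-leq {n = suc _} (suc a) zero {_ ∷ _ ∷ _} (x≤y ∷ s) = mk⇔
  (λ (¬x<y , h) → ℤ.≤-trans (to (⊨*-leq a zero s) h)
                            (ℤ.≮⇒≥ (λ x<y → fromInj₁ ⊥-elim ¬x<y (x<y , inj₁ id))))
  -- Here x ≤ y ≤ y_a ≤ x, so the first interval is a single point.
  (λ yₐ≤x → inj₁ (λ (x<y , _) → ℤ.<⇒≱ x<y (ℤ.≤-trans (first≤lookup s a) yₐ≤x))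
          , from (⊨*-leq a zero s) (ℤ.≤-trans yₐ≤x x≤y))
⊨*-leq {n = suc _} (suc a) (suc b) {_ ∷ _ ∷ _} (_ ∷ s) =
  mk⇔ (to (⊨*-leq a b s) ∘ proj₂) (λ h → inj₁ id , from (⊨*-leq a b s) h)

-- The formula about an eliminated first or last point becomes a conjunct on the neighbouring
-- interval, so one interval has to survive.
project : Fin (suc (suc (suc m))) → Rectangle V (suc (suc m)) → Rectangle V (suc m)
project             zero                (A ∷ B ∷ As) = (◇ₗ A ∧ᶠ B) ∷ As
project             (suc zero)          (A ∷ B ∷ As) = (A ⨾ B) ∷ As
project {m = zero}  (suc (suc zero))    (A ∷ B ∷ []) = (A ∧ᶠ ◇ᵣ B) ∷ []
-- The index stays positive: the eliminated point still follows a remaining one, so the `◇ₗ` case is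
-- not entered.
project {m = suc _} (suc (suc t))       (A ∷ As)     = A ∷ project (suc t) As

-- De Morgan: one rectangle for each component that may fail, unconstrained elsewhere.
complement : Rectangle V n → List (Rectangle V n)
complement []       = []
complement (A ∷ As) = (¬ᶠ A ∷ full) ∷ List.map (⊤ᶠ ∷_) (complement As)

⋁ : List (Rectangle V 1) → Formula V
⋁ []              = ⊥ᶠ
⋁ ((A ∷ []) ∷ Rs) = A ∨ᶠ ⋁ Rs

-- The guards `q ≡ p` and `q ≢ p` replace a case distinction, so that membership is a Boolean
-- combination of relations already known to be rectangular.
Mark : Trace V → V → List ℤ → Trace V
Mark σ p ks l q = (q ≡ p × l ∈ˡ ks) ⊎ (q ≢ p × q ∈ σ l)

Relation : Set → ℕ → Set₁
Relation V n = Trace V → Vec ℤ n → Set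

-- The list is chosen before `σ` and `ys`; this uniformity is what yields one formula for all traces
-- and intervals.
record Rectangular (P : Relation V (suc n)) : Set₁ where
  constructor rectangular
  field
    rectangles : List (Rectangle V n)
    correct    : ∀ {σ ys} → Sorted ys → Any (σ ⟨ ys ⟩⊨*_) rectangles ⇔ P σ ys

open Rectangular

-- Semantics of the Boolean operations and of projection.

module Classical (em : ExcludedMiddle 0ℓ) where

  ⊨-∧ : (σ ⟨ i , j ⟩⊨ (A ∧ᶠ B)) ⇔ (σ ⟨ i , j ⟩⊨ A × σ ⟨ i , j ⟩⊨ B)
  ⊨-∧ {σ = σ} {i = i} {j = j} {A = A} {B = B} = mk⇔ f (λ (a , b) → inj₁ λ where
      (inj₁ ¬a)        → ¬a a
      (inj₂ (inj₁ ¬b)) → ¬b b)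
    where
    f : σ ⟨ i , j ⟩⊨ (A ∧ᶠ B) → σ ⟨ i , j ⟩⊨ A × σ ⟨ i , j ⟩⊨ B
    f (inj₁ h) with em {σ ⟨ i , j ⟩⊨ A} | em {σ ⟨ i , j ⟩⊨ B}
    ... | yes a | yes b = a , b
    ... | no ¬a | _     = ⊥-elim (h (inj₁ ¬a))
    ... | yes _ | no ¬b = ⊥-elim (h (inj₂ (inj₁ ¬b)))

  ⊨-∨ : (σ ⟨ i , j ⟩⊨ (A ∨ᶠ B)) ⇔ (σ ⟨ i , j ⟩⊨ A ⊎ σ ⟨ i , j ⟩⊨ B)
  ⊨-∨ {σ = σ} {i = i} {j = j} {A = A} {B = B} = mk⇔ f λ where
      (inj₁ a) → inj₁ (λ { (inj₁ ¬a) → ¬a a })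
      (inj₂ b) → inj₂ b
    where
    f : σ ⟨ i , j ⟩⊨ (A ∨ᶠ B) → σ ⟨ i , j ⟩⊨ A ⊎ σ ⟨ i , j ⟩⊨ B
    f (inj₂ b) = inj₂ b
    f (inj₁ h) with em {σ ⟨ i , j ⟩⊨ A}
    ... | yes a = inj₁ a
    ... | no ¬a = ⊥-elim (h (inj₁ ¬a))

  ⊨-⋁ : (Rs : List (Rectangle V 1)) →
        (σ ⟨ i , j ⟩⊨ ⋁ Rs) ⇔ Any (σ ⟨ i ∷ j ∷ [] ⟩⊨*_) Rs
  ⊨-⋁ [] = mk⇔ (λ ()) (λ ())
  ⊨-⋁ ((A ∷ []) ∷ Rs) = mk⇔
    ([ (λ a → here (a , _)) , there ∘ to (⊨-⋁ Rs) ]′ ∘ to (⊨-∨ {A = A} {B = ⋁ Rs}))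
    (from (⊨-∨ {A = A} {B = ⋁ Rs}) ∘ λ where
      (here (a , _)) → inj₁ a
      (there h)      → inj₂ (from (⊨-⋁ Rs) h))

  ⊨*-∧ : ∀ {As Bs : Rectangle V n} {ys} →
         (σ ⟨ ys ⟩⊨* Vec.zipWith _∧ᶠ_ As Bs) ⇔ (σ ⟨ ys ⟩⊨* As × σ ⟨ ys ⟩⊨* Bs)
  ⊨*-∧ {As = []}     {[]}     = mk⇔ _ _
  ⊨*-∧ {As = A ∷ As} {B ∷ Bs} {_ ∷ _ ∷ _} = mk⇔
    (λ (h , hs) → let a , b = to (⊨-∧ {A = A} {B = B}) h ; as , bs = to ⊨*-∧ hs
                  in (a , as) , (b , bs))
    (λ ((a , as) , (b , bs)) → from (⊨-∧ {A = A} {B = B}) (a , b) , from ⊨*-∧ (as , bs))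

  ⊨*-complement : ∀ (As : Rectangle V n) {ys} →
                  Any (σ ⟨ ys ⟩⊨*_) (complement As) ⇔ (¬ (σ ⟨ ys ⟩⊨* As))
  ⊨*-complement [] = mk⇔ (λ ()) (λ h → ⊥-elim (h _))
  ⊨*-complement {σ = σ} (A ∷ As) {x ∷ y ∷ ys} = mk⇔
    (λ { (here (¬a , _)) (a , _)  → fromInj₁ ⊥-elim ¬a a
       ; (there h)       (_ , as) → to (⊨*-complement As) (Any-map⁻ h) as })
    g
    where
    Any-map⁻ : ∀ {Rs} → Any (σ ⟨ x ∷ y ∷ ys ⟩⊨*_) (List.map (⊤ᶠ ∷_) Rs) →
               Any (σ ⟨ y ∷ ys ⟩⊨*_) Rs
    Any-map⁻ {_ ∷ _} (here (_ , h)) = here h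
    Any-map⁻ {_ ∷ _} (there h)      = there (Any-map⁻ h)

    Any-map⁺ : ∀ {Rs} → Any (σ ⟨ y ∷ ys ⟩⊨*_) Rs →
               Any (σ ⟨ x ∷ y ∷ ys ⟩⊨*_) (List.map (⊤ᶠ ∷_) Rs)
    Any-map⁺ (here h)  = here (inj₁ id , h)
    Any-map⁺ (there h) = there (Any-map⁺ h)

    g : ¬ (σ ⟨ x ∷ y ∷ ys ⟩⊨* (A ∷ As)) → Any (σ ⟨ x ∷ y ∷ ys ⟩⊨*_) (complement (A ∷ As))
    g h with em {σ ⟨ x , y ⟩⊨ A}
    ... | yes a = there (Any-map⁺ (from (⊨*-complement As) (λ as → h (a , as))))
    ... | no ¬a = here (inj₁ ¬a , ⊨*-full (y ∷ ys))

  ⊨*-project : ∀ t (As : Rectangle V (suc (suc m))) {ys} → Sorted ys →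
    (σ ⟨ ys ⟩⊨* project t As) ⇔ (∃[ z ] (Sorted (insertAt ys t z) × σ ⟨ insertAt ys t z ⟩⊨* As))
  ⊨*-project zero (A ∷ B ∷ As) {x ∷ y ∷ ys} s = mk⇔
    (λ (h , hs) → let (z , z≤x , a) , b = to (⊨-∧ {A = ◇ₗ A} {B = B}) h
                  in z , z≤x ∷ s , a , b , hs)
    (λ { (z , z≤x ∷ _ , a , b , hs) → from (⊨-∧ {A = ◇ₗ A} {B = B}) ((z , z≤x , a) , b) , hs })
  ⊨*-project (suc zero) (A ∷ B ∷ As) {x ∷ y ∷ ys} (_ ∷ s) = mk⇔
    (λ ((z , x≤z , z≤y , a , b) , hs) → z , x≤z ∷ z≤y ∷ s , a , b , hs)
    (λ { (z , x≤z ∷ z≤y ∷ _ , a , b , hs) → (z , x≤z , z≤y , a , b) , hs })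
  ⊨*-project {m = zero} (suc (suc zero)) (A ∷ B ∷ []) {x ∷ y ∷ []} (x≤y ∷ _) = mk⇔
    (λ (h , _) → let a , (z , y≤z , b) = to (⊨-∧ {A = A} {B = ◇ᵣ B}) h
                 in z , x≤y ∷ y≤z ∷ [-] , a , b , _)
    (λ { (z , _ ∷ y≤z ∷ _ , a , b , _) → from (⊨-∧ {A = A} {B = ◇ᵣ B}) (a , (z , y≤z , b)) , _ })
  ⊨*-project {m = suc _} (suc (suc t)) (A ∷ As) {x ∷ y ∷ ys} (x≤y ∷ s) = mk⇔
    (λ (a , h) → let z , s′ , hs = to (⊨*-project (suc t) As s) h in z , x≤y ∷ s′ , a , hs)
    (λ { (z , _ ∷ s′ , a , hs) → a , from (⊨*-project (suc t) As s) (z , s′ , hs) })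

  -- Closure properties of rectangular relations.

  private
    variable
      P Q : Relation V n

  resp-⇔ : (∀ {σ ys} → P σ ys ⇔ Q σ ys) → Rectangular P → Rectangular Q
  resp-⇔ P⇔Q P-rect = rectangular (rectangles P-rect) (λ s → ⇔-trans (correct P-rect s) P⇔Q)

  const-rect : (X : Set) → Rectangular {V} {n} (λ _ _ → X)
  const-rect X with em {X}
  ... | yes x = rectangular (full ∷ []) (λ {_} {ys} _ → mk⇔ (λ _ → x) (λ _ → here (⊨*-full ys)))
  ... | no ¬x = rectangular [] (λ _ → mk⇔ (λ ()) (⊥-elim ∘ ¬x))

  ⊎-rect : Rectangular P → Rectangular Q → Rectangular (λ σ ys → P σ ys ⊎ Q σ ys)
  ⊎-rect (rectangular Rs Rs⇔P) (rectangular Ss Ss⇔Q) = rectangular (Rs ++ Ss) λ s →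
    ⇔-trans (mk⇔ (Any.++⁻ Rs) [ Any.++⁺ˡ , Any.++⁺ʳ Rs ]′) (Rs⇔P s ⊎-⇔ Ss⇔Q s)

  ×-rect : Rectangular P → Rectangular Q → Rectangular (λ σ ys → P σ ys × Q σ ys)
  ×-rect (rectangular Rs Rs⇔P) (rectangular Ss Ss⇔Q) =
    rectangular (cartesianProductWith (Vec.zipWith _∧ᶠ_) Rs Ss) λ s →
    ⇔-trans (mk⇔ (Any.cartesianProductWith⁻ _ (to ⊨*-∧) Rs Ss)
                 (λ (r , s) → Any.cartesianProductWith⁺ _ (λ x y → from ⊨*-∧ (x , y)) r s))
            (Rs⇔P s ×-⇔ Ss⇔Q s)

  -- The complement of a union is the intersection of the complements, each of which is a union of
  -- rectangles.
  ¬-rect : Rectangular P → Rectangular (λ σ ys → ¬ P σ ys)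
  ¬-rect (rectangular Rs Rs⇔P) = rectangular (rectangles (none-rect Rs)) λ s →
    ⇔-trans (correct (none-rect Rs) s) (¬-cong-⇔ (Rs⇔P s))
    where
    none-rect : (Rs : List (Rectangle V n)) → Rectangular (λ σ ys → ¬ Any (σ ⟨ ys ⟩⊨*_) Rs)
    none-rect []       = resp-⇔ (mk⇔ (λ _ ()) _) (const-rect ⊤)
    none-rect (R ∷ Rs) =
      resp-⇔ (mk⇔ (λ { (¬r , _) (here r) → ¬r r ; (_ , ¬rs) (there rs) → ¬rs rs })
                  (λ h → h ∘ here , h ∘ there))
             (×-rect (rectangular (complement R) (λ _ → ⊨*-complement R)) (none-rect Rs))

  ∃Fin-rect : {P : Fin k → Relation V (suc n)} → (∀ t → Rectangular (P t)) →
              Rectangular (λ σ ys → ∃[ t ] P t σ ys)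
  ∃Fin-rect {k = zero}  _      = resp-⇔ (mk⇔ (λ ()) (λ ())) (const-rect ⊥)
  ∃Fin-rect {k = suc _} P-rect =
    resp-⇔ (mk⇔ [ (zero ,_) , (λ (t , h) → suc t , h) ]′
                (λ { (zero , h) → inj₁ h ; (suc t , h) → inj₂ (t , h) }))
           (⊎-rect (P-rect zero) (∃Fin-rect (P-rect ∘ suc)))

  ∃insert-rect : ∀ t {P : Relation V (suc (suc (suc m)))} → Rectangular P →
    Rectangular (λ σ ys → ∃[ z ] (Sorted (insertAt ys t z) × P σ (insertAt ys t z)))
  ∃insert-rect t (rectangular Rs Rs⇔P) = rectangular (List.map (project t) Rs) λ s → mk⇔
    (λ h → let z , s′ , r = Any-map⁻ s Rs h in z , s′ , to (Rs⇔P s′) r)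
    (λ (z , s′ , x) → Any-map⁺ s s′ (from (Rs⇔P s′) x))
    where
    Any-map⁻ : ∀ {ys} → Sorted ys → ∀ Rs → Any (σ ⟨ ys ⟩⊨*_) (List.map (project t) Rs) →
      ∃[ z ] (Sorted (insertAt ys t z) × Any (σ ⟨ insertAt ys t z ⟩⊨*_) Rs)
    Any-map⁻ s (R ∷ _)  (here h)  = let z , s′ , r = to (⊨*-project t R s) h in z , s′ , here r
    Any-map⁻ s (_ ∷ Rs) (there h) = let z , s′ , r = Any-map⁻ s Rs h in z , s′ , there r

    Any-map⁺ : ∀ {ys z} → Sorted ys → Sorted (insertAt ys t z) → ∀ {Rs} →
      Any (σ ⟨ insertAt ys t z ⟩⊨*_) Rs → Any (σ ⟨ ys ⟩⊨*_) (List.map (project t) Rs)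
    Any-map⁺ s s′ {R ∷ _} (here r)  = here (from (⊨*-project t R s) (_ , s′ , r))
    Any-map⁺ s s′         (there r) = there (Any-map⁺ s s′ r)

  -- Relations definable from the order and the variables.

  ≤-rect : (a b : Fin (suc n)) → Rectangular {V} (λ _ ys → lookup ys a ≤ lookup ys b)
  ≤-rect a b = rectangular (leq a b ∷ []) λ s →
    ⇔-trans (mk⇔ Any.singleton⁻ Any.singleton⁺) (⊨*-leq a b s)

  <-rect : (a b : Fin (suc n)) → Rectangular {V} (λ _ ys → lookup ys a < lookup ys b)
  <-rect a b = resp-⇔ (mk⇔ ℤ.≰⇒> ℤ.<⇒≱) (¬-rect (≤-rect b a))

  ≡-rect : (a b : Fin (suc n)) → Rectangular {V} (λ _ ys → lookup ys a ≡ lookup ys b)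
  ≡-rect a b = resp-⇔ (mk⇔ (λ (p , q) → ℤ.≤-antisym p q) (λ e → ℤ.≤-reflexive e , ℤ.≤-reflexive (sym e)))
                      (×-rect (≤-rect a b) (≤-rect b a))

  var-rect : (q : V) (a : Fin (suc (suc m))) → Rectangular (λ σ ys → q ∈ σ (lookup ys a))
  var-rect q a = rectangular (at q a ∷ []) λ {_} {ys} _ →
    ⇔-trans (mk⇔ Any.singleton⁻ Any.singleton⁺) (⊨*-at a ys)

  -- The arguments of a definable relation may be taken from the sorted points in
  -- any order and with repetitions.
  Definable : Relation V k → Set₁
  Definable {k = k} P =
    ∀ {m} (vs : Vec (Fin (suc (suc m))) k) → Rectangular (λ σ ys → P σ (Vec.map (lookup ys) vs))

  -- The place of `z` among the sorted points is unknown, so the union runs over all insertion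
  -- positions `t`. Each one adds a point and renames the arguments, which is why `Definable` ranges
  -- over every `m` and `vs`.
  ∃-definable : (P : Relation V (suc k)) → Definable P → Definable (λ σ ρ → ∃[ z ] P σ (z ∷ ρ))
  ∃-definable P P-def vs = rectangular (rectangles union) λ s → ⇔-trans (correct union s) (mk⇔
      (λ (t , z , _ , x) → z , subst (P _) (lookup-insertAt _ t z vs) x)
      (λ (z , x) → let t , s′ = insert-sorted z s
                   in t , z , s′ , subst (P _) (sym (lookup-insertAt _ t z vs)) x))
    where
    union : Rectangular _
    union = ∃Fin-rect (λ t → ∃insert-rect t (P-def (t ∷ Vec.map (punchIn t) vs)))

  -- Induction on the number of quantified points: each step moves the head of `xs` to the front of
  -- the parameters `ρ`.
  ∃Vec-definable : ∀ n (P : Trace V → Vec ℤ n → Vec ℤ k → Set) →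
    (∀ {m} (us : Vec (Fin (suc (suc m))) n) vs →
      Rectangular (λ σ ys → P σ (Vec.map (lookup ys) us) (Vec.map (lookup ys) vs))) →
    Definable (λ σ ρ → ∃[ xs ] P σ xs ρ)
  ∃Vec-definable zero P P-def vs =
    resp-⇔ (mk⇔ ([] ,_) (λ { ([] , x) → x })) (P-def [] vs)
  ∃Vec-definable (suc n) P P-def vs =
    resp-⇔ (mk⇔ (λ (z , xs , h) → z ∷ xs , h) (λ { (z ∷ xs , h) → z , xs , h }))
           (∃-definable (λ σ ρ → ∃[ xs ] P σ (Vec.head ρ ∷ xs) (Vec.tail ρ))
             (∃Vec-definable n (λ σ xs ρ → P σ (Vec.head ρ ∷ xs) (Vec.tail ρ))
               (λ { us (v ∷ vs) → P-def (v ∷ us) vs }))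
             vs)

  -- The integers are discrete, so the successor is definable from the order as the next larger
  -- point. This is what `○` requires.
  suc-rect : (a b : Fin (suc (suc m))) →
             Rectangular {V} (λ _ ys → lookup ys b ≡ ℤ.suc (lookup ys a))
  suc-rect a b =
    resp-⇔ (mk⇔ (λ (a<b , gap) → covers a<b gap) covered)
      (×-rect (<-rect a b)
        (¬-rect (∃-definable (λ { _ (z ∷ x ∷ y ∷ []) → x < z × z < y })
                             (λ { (z ∷ x ∷ y ∷ []) → ×-rect (<-rect x z) (<-rect z y) })
                             (a ∷ b ∷ []))))
    where
    covers : ∀ {x y} → x < y → ¬ (∃[ z ] (x < z × z < y)) → y ≡ ℤ.suc x
    covers x<y gap =
      -- If `ℤ.suc x` were below `y`, it would itself lie in the gap.
      ℤ.≤-antisym (ℤ.≮⇒≥ λ sx<y → gap (_ , ℤ.suc[i]≤j⇒i<j ℤ.≤-refl , sx<y)) (ℤ.i<j⇒suc[i]≤j x<y)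

    covered : ∀ {x y} → y ≡ ℤ.suc x → x < y × ¬ (∃[ z ] (x < z × z < y))
    covered refl = ℤ.suc[i]≤j⇒i<j ℤ.≤-refl , λ (_ , x<z , z<sx) → ℤ.<⇒≱ z<sx (ℤ.i<j⇒suc[i]≤j x<z)

  ∈-rect : (a : Fin (suc m)) (vs : Vec (Fin (suc m)) n) →
           Rectangular {V} (λ _ ys → lookup ys a ∈ˡ toList (Vec.map (lookup ys) vs))
  ∈-rect a []       = resp-⇔ (mk⇔ (λ ()) (λ ())) (const-rect ⊥)
  ∈-rect a (v ∷ vs) = resp-⇔ (mk⇔ [ here , there ]′ (λ { (here e) → inj₁ e ; (there h) → inj₂ h }))
                             (⊎-rect (≡-rect a v) (∈-rect a vs))

  unique-rect : (vs : Vec (Fin (suc m)) n) →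
                Rectangular {V} (λ _ ys → Unique (toList (Vec.map (lookup ys) vs)))
  unique-rect []       = resp-⇔ (mk⇔ (λ _ → []) _) (const-rect ⊤)
  unique-rect (v ∷ vs) =
    resp-⇔ (mk⇔ (λ (v∉ , u) → ¬Any⇒All¬ _ v∉ ∷ u) (λ { (v∉ ∷ u) → All¬⇒¬Any v∉ , u }))
           (×-rect (¬-rect (∈-rect v vs)) (unique-rect vs))

  -- Bounded quantification over `p`.

  module _ (p : V) where

    Marked : Formula V → Trace V → ℤ → ℤ → Vec ℤ n → Set
    Marked A σ i j xs = Mark σ p (toList xs) ⟨ i , j ⟩⊨ A

    -- The standard translation into first-order logic, by induction on `A`. The marked points are
    -- parameters, so `p` turns into equality with one of them, and each chop or modality quantifies
    -- over one new point `z`.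
    marked-rect : ∀ A (a b : Fin (suc (suc m))) (vs : Vec (Fin (suc (suc m))) n) →
      Rectangular (λ σ ys → Marked A σ (lookup ys a) (lookup ys b) (Vec.map (lookup ys) vs))
    marked-rect ⊥ᶠ      a b vs = const-rect ⊥
    marked-rect (var q) a b vs = ⊎-rect (×-rect (const-rect (q ≡ p)) (∈-rect a vs))
                                        (×-rect (const-rect (q ≢ p)) (var-rect q a))
    marked-rect (A ⊃ B) a b vs = ⊎-rect (¬-rect (marked-rect A a b vs)) (marked-rect B a b vs)
    marked-rect (A ⨾ B) a b vs = ∃-definable
      (λ { σ (z ∷ i ∷ j ∷ xs) → i ≤ z × z ≤ j × Marked A σ i z xs × Marked B σ z j xs })
      (λ { (z ∷ i ∷ j ∷ xs) → ×-rect (≤-rect i z) (×-rect (≤-rect z j)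
             (×-rect (marked-rect A i z xs) (marked-rect B z j xs))) })
      (a ∷ b ∷ vs)
    marked-rect (○ A)   a b vs = resp-⇔
      (mk⇔ (λ { (i<j , _ , refl , h) → i<j , h }) (λ (i<j , h) → i<j , _ , refl , h))
      (×-rect (<-rect a b) (∃-definable
        (λ { σ (z ∷ i ∷ j ∷ xs) → z ≡ ℤ.suc i × Marked A σ z j xs })
        (λ { (z ∷ i ∷ j ∷ xs) → ×-rect (suc-rect i z) (marked-rect A z j xs) })
        (a ∷ b ∷ vs)))
    marked-rect (◇ₗ A)  a b vs = ∃-definable
      (λ { σ (z ∷ i ∷ xs) → z ≤ i × Marked A σ z i xs })
      (λ { (z ∷ i ∷ xs) → ×-rect (≤-rect z i) (marked-rect A z i xs) })
      (a ∷ vs)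
    marked-rect (◇ᵣ A)  a b vs = ∃-definable
      (λ { σ (z ∷ j ∷ xs) → j ≤ z × Marked A σ j z xs })
      (λ { (z ∷ j ∷ xs) → ×-rect (≤-rect j z) (marked-rect A j z xs) })
      (b ∷ vs)

    Mark-∼ : ∀ ks → Mark σ p ks ∼[ p ] σ
    Mark-∼ ks l = (λ (h , q≢p) → inj₂ (q≢p ∘ sym , h) , q≢p)
                , (λ { (inj₁ (e , _) , q≢p) → ⊥-elim (q≢p (sym e)) ; (inj₂ (_ , h) , q≢p) → h , q≢p })

    -- Up to equivalence, a `p`-variant of `σ` is determined by a list of the points where `p`
    -- holds.
    ∼-Mark : ∀ {σ′ : Trace V} {ks} → σ′ ∼[ p ] σ → (∀ l → (l ∈ˡ ks) ⇔ (p ∈ σ′ l)) →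
             ∀ l q → (q ∈ σ′ l) ⇔ (q ∈ Mark σ p ks l)
    ∼-Mark σ′∼σ ks⇔ l q with em {q ≡ p}
    ... | yes refl = mk⇔ (λ h → inj₁ (refl , from (ks⇔ l) h))
                         (λ { (inj₁ (_ , h)) → to (ks⇔ l) h ; (inj₂ (p≢p , _)) → ⊥-elim (p≢p refl) })
    ... | no q≢p   = mk⇔ (λ h → inj₂ (q≢p , proj₁ (proj₂ (σ′∼σ l) (h , q≢p ∘ sym))))
                         (λ { (inj₁ (e , _)) → ⊥-elim (q≢p e)
                            ; (inj₂ (_ , h)) → proj₁ (proj₁ (σ′∼σ l) (h , q≢p ∘ sym)) })

    p∈Mark : ∀ ks l → (l ∈ˡ ks) ⇔ (p ∈ Mark σ p ks l)
    p∈Mark ks l = mk⇔ (λ h → inj₁ (refl , h))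
                      (λ { (inj₁ (_ , h)) → h ; (inj₂ (p≢p , _)) → ⊥-elim (p≢p refl) })

    -- The quantifier over traces becomes one over points: `t` is the cardinality, bounded by `n₂`
    -- through its type, and uniqueness makes the length of `xs` count points.
    Choice : ℕ → ℕ → Formula V → Trace V → ℤ → ℤ → Set
    Choice n₁ n₂ A σ i j = Σ[ t ∈ Fin (suc n₂) ] (n₁ ℕ.≤ toℕ t ×
      Σ[ xs ∈ Vec ℤ (toℕ t) ] (Unique (toList xs) × Marked A σ i j xs))

    choice-rect : ∀ n₁ n₂ A →
      Rectangular {n = 1} (λ σ ys → Choice n₁ n₂ A σ (lookup ys zero) (lookup ys (suc zero)))
    choice-rect n₁ n₂ A = ∃Fin-rect λ t → ×-rect (const-rect (n₁ ℕ.≤ toℕ t))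
      (∃Vec-definable (toℕ t)
        (λ { σ xs (i ∷ j ∷ []) → Unique (toList xs) × Marked A σ i j xs })
        (λ { us (a ∷ b ∷ []) → ×-rect (unique-rect us) (marked-rect A a b us) })
        (zero ∷ suc zero ∷ []))

    choice⇔∃ : ∀ {n₁ n₂ A} → Choice n₁ n₂ A σ i j ⇔ (σ ⟨ i , j ⟩⊨∃[ n₁ , n₂ ] p ∙ A)
    choice⇔∃ {σ = σ} {i = i} {j = j} {n₁} {n₂} {A} = mk⇔
      (λ (t , n₁≤t , xs , u , h) →
        Mark σ p (toList xs) , Mark-∼ (toList xs) , h ,
        toℕ t , (toList xs , u , length-toList xs , p∈Mark {σ = σ} (toList xs)) , n₁≤t , toℕ≤pred[n] t)
      g
      where
      g : σ ⟨ i , j ⟩⊨∃[ n₁ , n₂ ] p ∙ A → Choice n₁ n₂ A σ i j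
      g (σ′ , σ′∼σ , h , n , (ks , u , refl , ks⇔) , n₁≤n , n≤n₂) =
        fromℕ< (ℕ.s≤s n≤n₂) ,
        -- The length of the vector is `toℕ` of the chosen index, which equals the length of `ks`
        -- only propositionally.
        subst (λ n → n₁ ℕ.≤ n × Σ[ xs ∈ Vec ℤ n ] (Unique (toList xs) × Marked A σ i j xs))
          (sym (toℕ-fromℕ< (ℕ.s≤s n≤n₂)))
          (n₁≤n , fromList ks ,
           subst (λ ks → Unique ks × Mark σ p ks ⟨ i , j ⟩⊨ A) (sym (toList∘fromList ks))
             (u , to (⊨-cong (∼-Mark σ′∼σ ks⇔) A) h))

theorem15 : ExcludedMiddle 0ℓ →
    (V : Set) (A : Formula V) (p : V) (n₁ n₂ : ℕ) → n₁ ℕ.≤ n₂ →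
    ∃[ A′ ] (∀ (σ : Trace V) (i j : ℤ) → i ≤ j →
    (σ ⟨ i , j ⟩⊨ A′) ⇔ (σ ⟨ i , j ⟩⊨∃[ n₁ , n₂ ] p ∙ A))
theorem15 em V A p n₁ n₂ _ = ⋁ (rectangles A-rect) , λ σ i j i≤j →
  ⇔-trans (⊨-⋁ (rectangles A-rect)) (⇔-trans (correct A-rect (i≤j ∷ [-])) (choice⇔∃ p {σ = σ} {A = A}))
  where
  open Classical em
  A-rect = choice-rect p n₁ n₂ A
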